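{- Let $n>17$ be an integer. Then $\gamma^{LD}(C_n(1,3)) = \lceil n/3\rceil$ if $n\equiv 0,1,4\pmod 6$, and $\gamma^{LD}(C_n(1,3)) = \lceil n/3\rceil+1$ otherwise.
   Context: For a positive integer $n$, the circulant graph $C_n(1,3)$ has vertex set $\mathbb{Z}_n$, and $u$ is adjacent to $u\pm1$ and $u\pm 3$ (modulo $n$); $N[u]=\{u,u\pm1,u\pm3\}$. For a code (nonempty subset) $C\subseteq\mathbb{Z}_n$, $I(C;u)=N[u]\cap C$. $C$ is locating-dominating if $I(C;u)\neq\emptyset$ for all vertices $u$ and $I(C;u)\neq I(C;v)$ for all distinct $u,v\in\mathbb{Z}_n\setminus C$. $\gamma^{LD}(G)$ is the minimum cardinality of a locating-dominating code in $G$. -}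

module Defs where

open import Data.Nat using (ℕ; suc; _+_; _∸_; _≤_; _%_; _/_; NonZero)
open import Data.Fin using (Fin; toℕ)
open import Data.Fin.Subset using (Subset; _∈_; _∉_; _∩_; Nonempty; ∣_∣)
open import Data.Vec using (tabulate)
open import Data.Bool using (Bool; _∨_)
open import Data.Product using (_×_; Σ; _,_)
open import Relation.Nullary using (¬_; does)
open import Relation.Binary.PropositionalEquality using (_≡_)
import Data.Nat as ℕ

-- Vertices of C_n(1,3) are Fin n (i.e. Z_n), n nonzero.
-- v is in the closed neighbourhood N[u] iff v ≡ u, u+1, u-1, u+3, u-3 (mod n).
-- Residues u-1, u-3 are computed as u + (n-1), u + (n-3) mod n (requires n ≥ 3,
-- which holds in the theorem; for n ≥ 3 these are exactly u-1, u-3 mod n).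
_≡ₙ_ : {n : ℕ} → ℕ → ℕ → Bool
_≡ₙ_ {n} a b = does ((a % suc (n ∸ 1)) ℕ.≟ (b % suc (n ∸ 1)))

inN : (n : ℕ) → Fin n → Fin n → Bool
inN n u v =
  let x = toℕ u ; y = toℕ v in
  _≡ₙ_ {n} y x ∨ _≡ₙ_ {n} y (x + 1) ∨ _≡ₙ_ {n} y (x + (n ∸ 1))
    ∨ _≡ₙ_ {n} y (x + 3) ∨ _≡ₙ_ {n} y (x + (n ∸ 3))

N[_] : {n : ℕ} → Fin n → Subset n
N[_] {n} u = tabulate (inN n u)

I : {n : ℕ} → Subset n → Fin n → Subset n
I C u = N[ u ] ∩ C

IsLD : (n : ℕ) → Subset n → Set
IsLD n C =
  Nonempty C
  × ((u : Fin n) → Nonempty (I C u))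
  × ((u v : Fin n) → u ∉ C → v ∉ C → ¬ (u ≡ v) → ¬ (I C u ≡ I C v))

γLD≡ : (n : ℕ) → ℕ → Set
γLD≡ n k = Σ (Subset n) (λ C → IsLD n C × ∣ C ∣ ≡ k)
           × ((C : Subset n) → IsLD n C → k ≤ ∣ C ∣)

⌈_/3⌉ : ℕ → ℕ
⌈ n /3⌉ = (n + 2) / 3

{-# OPTIONS --safe #-}
module Submission where

-- A code is locating-dominating iff it meets every translate of four finite sets: a closed
-- neighbourhood, and the symmetric differences of the closed neighbourhoods of two vertices
-- at difference 2, 4 or 6. For the n-periodic indicator word c of the code this is a condition
-- on its factors of length 13.
--
-- Lower bound: give cost 1 to a step from one window of length 12 to the next, except that a
-- step from a window of (110000)^∞ costs 0 if it stays in this word and 18 if it leaves it.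
-- There is a potential on windows such that a step appending the letter b satisfies
-- cost + Δpotential ≤ 17 (3 b − 1); summing over a period gives total cost ≤ 17 (3 |C| − n).
-- Hence n ≤ 3 |C|. If 6 ∤ n, then c is not (110000)^∞, so it either leaves this word at some
-- step or never meets it; as n ≥ 18 the total cost is at least 18 and 3 |C| ≥ n + 2.
--
-- Upper bound: blocks 110000 followed by one of six tails, according to n mod 6.

open import Defs
open import Data.Nat using (ℕ; _<_; _%_; _+_)
open import Data.Sum using (_⊎_)
open import Data.Product using (_×_)
open import Relation.Nullary using (¬_)
open import Relation.Binary.PropositionalEquality using (_≡_)

open import Data.Bool as Bool using (Bool; true; false; T; _∨_; _∧_; not; if_then_else_)
open import Data.Bool.ListAction using (any; all)
open import Data.Bool.Properties using (∨-identityʳ; T-≡; T-∧; T-∨)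
open import Data.Fin as Fin using (Fin; toℕ)
open import Data.Fin.Patterns
open import Data.Fin.Properties using (toℕ-fromℕ<; toℕ-injective; toℕ<n)
open import Data.Fin.Subset using (Subset; _∈_; _∉_; Nonempty; ∣_∣)
open import Data.Fin.Subset.Properties using (x∈p∩q⁺; x∈p∩q⁻; ⊆-antisym; _∈?_)
open import Data.List using (List; []; _∷_; _++_; map; filter; length; drop; take; upTo)
open import Data.List.Membership.Propositional using (find; lose)
open import Data.List.Membership.Propositional.Properties
  using (∈-filter⁺; ∈-filter⁻; ∈-++⁺ˡ; ∈-++⁺ʳ; ∈-++⁻; ∈-map⁺; ∈-map⁻)
open import Data.List.Properties using (≡-dec; length-++)
open import Data.List.Relation.Unary.All as All using (All; []; _∷_; all?)
open import Data.List.Relation.Unary.All.Properties using (map⁻; all⁺; all⁻)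
open import Data.List.Relation.Unary.Any as Any using (Any; here; there; any?)
open import Data.List.Relation.Unary.Any.Properties using (any⁺; any⁻)
open import Data.Nat
open import Data.Nat.DivMod
open import Data.Nat.Divisibility using (divides)
open import Data.Nat.Properties
open import Data.Nat.Tactic.RingSolver using (solve-∀)
open import Data.Product using (∃; ∃₂; _,_; proj₁; proj₂)
open import Data.Sum using (inj₁; inj₂; [_,_]; [_,_]′)
open import Data.Vec using ([]; _∷_; lookup; tabulate)
open import Data.Vec.Properties using (lookup∘tabulate; lookup⇒[]=; []=⇒lookup)
open import Function using (_∘_; Equivalence)
open import Relation.Binary.PropositionalEquality hiding ([_])
open import Relation.Nullary using (yes; no; contradiction; does)
open import Relation.Nullary.Decidable using (toWitness; from-yes; _⊎-dec_; True; ¬?; dec-true; dec-false)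
open import Data.List.Membership.DecPropositional _≟_
  using (_∉?_) renaming (_∈_ to _∈ₗ_; _∉_ to _∉ₗ_; _∈?_ to _∈ₗ?_)
open import Data.List.Membership.DecPropositional (≡-dec Bool._≟_)
  using () renaming (_∈_ to _∈ᵥ_; _∈?_ to _∈ᵥ?_)

-- Congruences modulo n.

%-cancelʳ : ∀ n .{{_ : NonZero n}} a b c → (a + c) % n ≡ (b + c) % n → a % n ≡ b % n
%-cancelʳ n@(suc m) a b c eq = trans (sym (lift a)) (trans step (lift b))
  where
  -- Since `n` is `suc m`, the summands `c` and `c * m` add up to a multiple of `n`.
  lift : ∀ x → ((x + c) + c * m) % n ≡ x % n
  lift x = trans (cong (_% n) (trans (+-assoc x c (c * m)) (cong (x +_) (sym (*-suc c m))))) ([m+kn]%n≡m%n x c n)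
  step : ((a + c) + c * m) % n ≡ ((b + c) + c * m) % n
  step = trans (%-distribˡ-+ (a + c) (c * m) n)
        (trans (cong (λ z → (z + (c * m) % n) % n) eq) (sym (%-distribˡ-+ (b + c) (c * m) n)))

[m%n+o]%n≡[m+o]%n : ∀ m o n .{{_ : NonZero n}} → (m % n + o) % n ≡ (m + o) % n
[m%n+o]%n≡[m+o]%n m o n = trans (%-distribˡ-+ (m % n) o n)
  (trans (cong (λ z → (z + o % n) % n) (m%n%n≡m%n m n)) (sym (%-distribˡ-+ m o n)))

-- Offsets and symmetric differences of closed neighbourhoods.

-- The closed neighbourhood of the vertex j + 3 is {j + e | e ∈ offsets}: basing windows
-- at their left end avoids subtraction.
offsets : List ℕ
offsets = 3 ∷ 4 ∷ 2 ∷ 6 ∷ 0 ∷ []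

symDiff : ℕ → List ℕ
symDiff d = filter (_∉? map (d +_) offsets) offsets ++ filter (_∉? offsets) (map (d +_) offsets)

-- Vertices outside the code with the same nonempty trace I(C; ·) differ by 2, 4 or 6,
-- the differences of the elements of offsets other than the centre 3.
constraints : List (List ℕ)
constraints = offsets ∷ map symDiff (2 ∷ 4 ∷ 6 ∷ [])

∈-symDiff⁺ˡ : ∀ d {e} → e ∈ₗ offsets → e ∉ₗ map (d +_) offsets → e ∈ₗ symDiff d
∈-symDiff⁺ˡ d p q = ∈-++⁺ˡ (∈-filter⁺ (_∉? map (d +_) offsets) p q)

∈-symDiff⁺ʳ : ∀ d {e} → e ∈ₗ map (d +_) offsets → e ∉ₗ offsets → e ∈ₗ symDiff d
∈-symDiff⁺ʳ d p q =
  ∈-++⁺ʳ (filter (_∉? map (d +_) offsets) offsets) (∈-filter⁺ (_∉? offsets) p q)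

∈-symDiff⁻ : ∀ d {e} → e ∈ₗ symDiff d →
  (e ∈ₗ offsets × e ∉ₗ map (d +_) offsets) ⊎ (e ∈ₗ map (d +_) offsets × e ∉ₗ offsets)
∈-symDiff⁻ d p with ∈-++⁻ (filter (_∉? map (d +_) offsets) offsets) p
... | inj₁ q = inj₁ (∈-filter⁻ (_∉? map (d +_) offsets) q)
... | inj₂ q = inj₂ (∈-filter⁻ (_∉? offsets) q)

-- Locating-dominating codes as hitting sets.

module Circulant (m : ℕ) (12<n : 12 < suc m) where

  n : ℕ
  n = suc m

  3≤n : 3 ≤ n
  3≤n = ≤-trans (s≤s (s≤s (s≤s z≤n))) 12<n

  -- Abstract, so that unification can recover i from ⟨ i ⟩.
  abstract
    ⟨_⟩ : ℕ → Fin n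
    ⟨ i ⟩ = i mod n

    toℕ-⟨⟩ : ∀ i → toℕ ⟨ i ⟩ ≡ i % n
    toℕ-⟨⟩ i = toℕ-fromℕ< (m%n<n i n)

  ⟨⟩-cong : ∀ {i j} → i % n ≡ j % n → ⟨ i ⟩ ≡ ⟨ j ⟩
  ⟨⟩-cong {i} {j} eq = toℕ-injective (trans (toℕ-⟨⟩ i) (trans eq (sym (toℕ-⟨⟩ j))))

  ⟨⟩-injective : ∀ {i j} → ⟨ i ⟩ ≡ ⟨ j ⟩ → i % n ≡ j % n
  ⟨⟩-injective {i} {j} eq = trans (sym (toℕ-⟨⟩ i)) (trans (cong toℕ eq) (toℕ-⟨⟩ j))

  ⟨+⟩-injective : ∀ j {e f} → e < n → f < n → ⟨ j + e ⟩ ≡ ⟨ j + f ⟩ → e ≡ f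
  ⟨+⟩-injective j {e} {f} e<n f<n eq = begin
    e     ≡⟨ m<n⇒m%n≡m e<n ⟨
    e % n ≡⟨ %-cancelʳ n e f j (subst₂ (λ x y → x % n ≡ y % n) (+-comm j e) (+-comm j f) (⟨⟩-injective eq)) ⟩
    f % n ≡⟨ m<n⇒m%n≡m f<n ⟩
    f     ∎
    where open ≡-Reasoning

  ⟨+⟩-shift : ∀ i j e f → ⟨ i + e ⟩ ≡ ⟨ j + e ⟩ → ⟨ i + f ⟩ ≡ ⟨ j + f ⟩
  ⟨+⟩-shift i j e f eq = ⟨⟩-cong (trans (sym ([m%n+o]%n≡[m+o]%n i f n))
    (trans (cong (λ x → (x + f) % n) (%-cancelʳ n i j e (⟨⟩-injective eq))) ([m%n+o]%n≡[m+o]%n j f n)))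

  centred : ∀ u → ∃ λ j → u ≡ ⟨ j + 3 ⟩
  centred u = toℕ u + (n ∸ 3) , toℕ-injective (begin
    toℕ u                        ≡⟨ m<n⇒m%n≡m (toℕ<n u) ⟨
    toℕ u % n                    ≡⟨ [m+n]%n≡m%n (toℕ u) n ⟨
    (toℕ u + n) % n              ≡⟨ cong (λ x → (toℕ u + x) % n) (m∸n+n≡m 3≤n) ⟨
    (toℕ u + ((n ∸ 3) + 3)) % n  ≡⟨ cong (_% n) (+-assoc (toℕ u) (n ∸ 3) 3) ⟨
    (toℕ u + (n ∸ 3) + 3) % n    ≡⟨ toℕ-⟨⟩ (toℕ u + (n ∸ 3) + 3) ⟨
    toℕ ⟨ toℕ u + (n ∸ 3) + 3 ⟩  ∎)
    where open ≡-Reasoning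

  -- `offsets` follows the order of the disjuncts of `inN`, so the two sides agree term by term;
  -- `any` only adds a final `false`.
  inN-offsets : ∀ j v → inN n ⟨ j + 3 ⟩ v ≡ any (λ e → _≡ₙ_ {n} (toℕ v) (j + e)) offsets
  inN-offsets j v
    = cong₂ _∨_ (test plain) (cong₂ _∨_ (test (plus 1)) (cong₂ _∨_ (test (minus 2 1 refl (s≤s z≤n)))
       (cong₂ _∨_ (test (plus 3)) (trans (test (minus 0 3 refl 3≤n))
         (sym (∨-identityʳ _))))))
    where
    x = toℕ ⟨ j + 3 ⟩
    test : ∀ {r s} → r ≡ s → does (toℕ v % n ≟ r) ≡ does (toℕ v % n ≟ s)
    test = cong (λ z → does (toℕ v % n ≟ z))
    plain : x % n ≡ (j + 3) % n
    plain = trans (cong (_% n) (toℕ-⟨⟩ (j + 3))) (m%n%n≡m%n (j + 3) n)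
    plus : ∀ k → (x + k) % n ≡ (j + (3 + k)) % n
    plus k = trans (cong (λ z → (z + k) % n) (toℕ-⟨⟩ (j + 3)))
      (trans ([m%n+o]%n≡[m+o]%n (j + 3) k n) (cong (_% n) (+-assoc j 3 k)))
    minus : ∀ e k → 3 ≡ e + k → k ≤ n → (x + (n ∸ k)) % n ≡ (j + e) % n
    minus e k 3≡ k≤n = begin
      (x + (n ∸ k)) % n            ≡⟨ plus (n ∸ k) ⟩
      (j + (3 + (n ∸ k))) % n      ≡⟨ cong (λ z → (j + (z + (n ∸ k))) % n) 3≡ ⟩
      (j + (e + k + (n ∸ k))) % n  ≡⟨ cong (λ z → (j + z) % n) (trans (+-assoc e k (n ∸ k)) (cong (e +_) (m+[n∸m]≡n k≤n))) ⟩
      (j + (e + n)) % n            ≡⟨ cong (_% n) (+-assoc j e n) ⟨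
      (j + e + n) % n              ≡⟨ [m+n]%n≡m%n (j + e) n ⟩
      (j + e) % n                  ∎
      where open ≡-Reasoning

  ≡ₙ⇒≡⟨⟩ : ∀ {v i} → T (_≡ₙ_ {n} (toℕ v) i) → v ≡ ⟨ i ⟩
  ≡ₙ⇒≡⟨⟩ {v} {i} p = toℕ-injective (trans (sym (m<n⇒m%n≡m (toℕ<n v)))
    (trans (≡ᵇ⇒≡ (toℕ v % n) (i % n) p) (sym (toℕ-⟨⟩ i))))

  ≡⟨⟩⇒≡ₙ : ∀ {v i} → v ≡ ⟨ i ⟩ → T (_≡ₙ_ {n} (toℕ v) i)
  ≡⟨⟩⇒≡ₙ {v} {i} refl = ≡⇒≡ᵇ _ (i % n) (trans (m<n⇒m%n≡m (toℕ<n v)) (toℕ-⟨⟩ i))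

  module _ (C : Subset n) where

    Hit : ℕ → List ℕ → Set
    Hit j = Any (λ e → ⟨ j + e ⟩ ∈ C)

    Hitting : Set
    Hitting = ∀ j → All (Hit j) constraints

    ∈I⁻ : ∀ j {v} → v ∈ I C ⟨ j + 3 ⟩ → ∃ λ e → e ∈ₗ offsets × v ≡ ⟨ j + e ⟩ × v ∈ C
    ∈I⁻ j {v} v∈I with x∈p∩q⁻ N[ ⟨ j + 3 ⟩ ] C v∈I
    ... | v∈N , v∈C with find (any⁻ (λ e → _≡ₙ_ {n} (toℕ v) (j + e)) offsets
          (Equivalence.from T-≡ (trans (sym (inN-offsets j v))
            (trans (sym (lookup∘tabulate (inN n ⟨ j + 3 ⟩) v)) ([]=⇒lookup v∈N)))))
    ... | e , e∈ , v≡ₙ = e , e∈ , ≡ₙ⇒≡⟨⟩ {i = j + e} v≡ₙ , v∈C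

    ∈I⁺ : ∀ j {e v} → e ∈ₗ offsets → v ≡ ⟨ j + e ⟩ → v ∈ C → v ∈ I C ⟨ j + 3 ⟩
    ∈I⁺ j {e} {v} e∈ v≡ v∈C = x∈p∩q⁺ (lookup⇒[]= v _ (trans (lookup∘tabulate (inN n ⟨ j + 3 ⟩) v)
      (trans (inN-offsets j v) (Equivalence.to T-≡
        (any⁺ (λ e → _≡ₙ_ {n} (toℕ v) (j + e)) (lose e∈ (≡⟨⟩⇒≡ₙ {i = j + e} v≡)))))) , v∈C)

    ∈I-shift⁻ : ∀ j d {v} → v ∈ I C ⟨ j + d + 3 ⟩ → ∃ λ e → e ∈ₗ map (d +_) offsets × v ≡ ⟨ j + e ⟩ × v ∈ C
    ∈I-shift⁻ j d v∈I with ∈I⁻ (j + d) v∈I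
    ... | e , e∈ , v≡ , v∈C = d + e , ∈-map⁺ (d +_) e∈ , trans v≡ (cong ⟨_⟩ (+-assoc j d e)) , v∈C

    ∈I-shift⁺ : ∀ j d {e v} → e ∈ₗ map (d +_) offsets → v ≡ ⟨ j + e ⟩ → v ∈ C → v ∈ I C ⟨ j + d + 3 ⟩
    ∈I-shift⁺ j d e∈ v≡ v∈C with ∈-map⁻ (d +_) e∈
    ... | f , f∈ , refl = ∈I⁺ (j + d) f∈ (trans v≡ (cong ⟨_⟩ (sym (+-assoc j d f)))) v∈C

    -- If the translate of `symDiff d` missed the code, the traces of `j + 3` and `j + d + 3` would
    -- coincide. The hypotheses place both centres in this translate, hence outside the code, and
    -- keep them distinct, which contradicts separation.
    separated⇒hit : ∀ j d → 3 ∈ₗ symDiff d → d + 3 ∈ₗ symDiff d → 3 ≢ d + 3 → d + 3 < n →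
      IsLD n C → Hit j (symDiff d)
    separated⇒hit j d 3∈ d+3∈ 3≢d+3 d+3<n (_ , _ , separating) with any? (λ e → ⟨ j + e ⟩ ∈? C) (symDiff d)
    ... | yes hit = hit
    ... | no miss = contradiction (⊆-antisym sub sup)
            (separating ⟨ j + 3 ⟩ ⟨ j + d + 3 ⟩
              (λ ∈C → miss (lose 3∈ ∈C))
              (λ ∈C → miss (lose d+3∈ (subst (λ i → ⟨ i ⟩ ∈ C) (+-assoc j d 3) ∈C)))
              (λ eq → 3≢d+3 (⟨+⟩-injective j (≤-trans (s≤s (m≤n+m 3 d)) d+3<n) d+3<n
                (trans eq (cong ⟨_⟩ (+-assoc j d 3))))))
      where
      sub : ∀ {v} → v ∈ I C ⟨ j + 3 ⟩ → v ∈ I C ⟨ j + d + 3 ⟩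
      sub v∈I with ∈I⁻ j v∈I
      ... | e , e∈ , v≡ , v∈C with e ∈ₗ? map (d +_) offsets
      ... | yes e∈′ = ∈I-shift⁺ j d e∈′ v≡ v∈C
      ... | no e∉′ = contradiction (lose (∈-symDiff⁺ˡ d e∈ e∉′) (subst (_∈ C) v≡ v∈C)) miss
      sup : ∀ {v} → v ∈ I C ⟨ j + d + 3 ⟩ → v ∈ I C ⟨ j + 3 ⟩
      sup v∈I with ∈I-shift⁻ j d v∈I
      ... | e , e∈ , v≡ , v∈C with e ∈ₗ? offsets
      ... | yes e∈′ = ∈I⁺ j e∈′ v≡ v∈C
      ... | no e∉′ = contradiction (lose (∈-symDiff⁺ʳ d e∈ e∉′) (subst (_∈ C) v≡ v∈C)) miss

    IsLD⇒Hitting : IsLD n C → Hitting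
    IsLD⇒Hitting ld@(_ , dominating , _) j =
      dominated (dominating ⟨ j + 3 ⟩) ∷ separated 2 ∷ separated 4 ∷ separated 6 ∷ []
      where
      dominated : Nonempty (I C ⟨ j + 3 ⟩) → Hit j offsets
      dominated (v , v∈I) with ∈I⁻ j v∈I
      ... | e , e∈ , v≡ , v∈C = lose e∈ (subst (_∈ C) v≡ v∈C)
      -- For a literal `d` these side conditions are decided by evaluation.
      separated : ∀ d → {True (3 ∈ₗ? symDiff d)} → {True (d + 3 ∈ₗ? symDiff d)} →
        {True (¬? (3 ≟ d + 3))} → {True (d + 3 ≤? 12)} → Hit j (symDiff d)
      separated d {3∈} {d+3∈} {3≢} {d≤} = separated⇒hit j d (toWitness 3∈) (toWitness d+3∈)
        (toWitness 3≢) (≤-trans (s≤s (toWitness d≤)) 12<n) ld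

    -- A codeword in the symmetric difference lies in only one of the two traces: the offsets
    -- involved are at most 12, below `n`, so distinct offsets from `j` give distinct vertices.
    hit⇒separated : ∀ j d → d ≤ 6 → Hit j (symDiff d) → I C ⟨ j + 3 ⟩ ≢ I C ⟨ j + d + 3 ⟩
    hit⇒separated j d d≤6 hit I≡I with find hit
    ... | e , e∈ , ∈C = [ left , right ] (∈-symDiff⁻ d e∈)
      where
      ∈offsets⇒<n : ∀ {f} → f ∈ₗ offsets → f < n
      ∈offsets⇒<n f∈ = ≤-trans (s≤s (All.lookup (from-yes (all? (_≤? 12) offsets)) f∈)) 12<n
      ∈shifted⇒<n : ∀ {f} → f ∈ₗ map (d +_) offsets → f < n
      ∈shifted⇒<n f∈ with ∈-map⁻ (d +_) f∈
      ... | g , g∈ , refl =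
        ≤-trans (s≤s (+-mono-≤ d≤6 (All.lookup (from-yes (all? (_≤? 6) offsets)) g∈))) 12<n
      left : ¬ (e ∈ₗ offsets × e ∉ₗ map (d +_) offsets)
      left (e∈₁ , e∉₂) with ∈I-shift⁻ j d (subst (⟨ j + e ⟩ ∈_) I≡I (∈I⁺ j e∈₁ refl ∈C))
      ... | f , f∈₂ , eq , _ =
        e∉₂ (subst (_∈ₗ map (d +_) offsets) (sym (⟨+⟩-injective j (∈offsets⇒<n e∈₁) (∈shifted⇒<n f∈₂) eq)) f∈₂)
      right : ¬ (e ∈ₗ map (d +_) offsets × e ∉ₗ offsets)
      right (e∈₂ , e∉₁) with ∈I⁻ j (subst (⟨ j + e ⟩ ∈_) (sym I≡I) (∈I-shift⁺ j d e∈₂ refl ∈C))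
      ... | f , f∈₁ , eq , _ =
        e∉₁ (subst (_∈ₗ offsets) (sym (⟨+⟩-injective j (∈shifted⇒<n e∈₂) (∈offsets⇒<n f∈₁) eq)) f∈₁)

    -- Vertices with equal traces share a codeword, at offsets `e` and `f` from their bases. If one
    -- of these is the centre 3, that vertex is itself a codeword; otherwise the bases differ by 0,
    -- 2, 4 or 6 and `conflict` applies.
    Hitting⇒IsLD : Hitting → IsLD n C
    Hitting⇒IsLD hitting = nonempty (All.head (hitting 0)) , dominating , separating
      where
      nonempty : Hit 0 offsets → Nonempty C
      nonempty hit with find hit
      ... | e , _ , ∈C = ⟨ e ⟩ , ∈C

      dominating : ∀ u → Nonempty (I C u)
      dominating u with centred u
      ... | j , refl with find (All.head (hitting j))
      ... | e , e∈ , ∈C = ⟨ j + e ⟩ , ∈I⁺ j e∈ refl ∈C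

      -- `d = 0` would make the vertices equal; every other `d` is excluded by the constraint
      -- `symDiff d`.
      conflict : ∀ i j {e} d → d ∈ₗ (0 ∷ 2 ∷ 4 ∷ 6 ∷ []) → ⟨ j + (d + e) ⟩ ≡ ⟨ i + e ⟩ → ⟨ j + 3 ⟩ ≢ ⟨ i + 3 ⟩ →
        I C ⟨ j + 3 ⟩ ≢ I C ⟨ i + 3 ⟩
      conflict i j {e} d d∈ eq u≢v I≡I = differ d∈
        where
        v≡ : ⟨ j + d + 3 ⟩ ≡ ⟨ i + 3 ⟩
        v≡ = ⟨+⟩-shift (j + d) i e 3 (trans (cong ⟨_⟩ (+-assoc j d e)) eq)
        I≡I′ : I C ⟨ j + 3 ⟩ ≡ I C ⟨ j + d + 3 ⟩
        I≡I′ = trans I≡I (cong (I C) (sym v≡))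
        differ : ¬ (d ∈ₗ (0 ∷ 2 ∷ 4 ∷ 6 ∷ []))
        differ (here refl) = u≢v (trans (cong (λ x → ⟨ x + 3 ⟩) (sym (+-identityʳ j))) v≡)
        differ (there d∈′) = hit⇒separated j d
          (All.lookup (from-yes (all? (_≤? 6) (2 ∷ 4 ∷ 6 ∷ []))) d∈′)
          (All.lookup (map⁻ {f = symDiff} (All.tail (hitting j))) d∈′) I≡I′

      differences : All (λ e → All (λ f → e ≡ 3 ⊎ f ≡ 3 ⊎
        Any (λ d → d + f ≡ e ⊎ d + e ≡ f) (0 ∷ 2 ∷ 4 ∷ 6 ∷ [])) offsets) offsets
      differences = from-yes (all? (λ e → all? (λ f → e ≟ 3 ⊎-dec f ≟ 3 ⊎-dec
        any? (λ d → d + f ≟ e ⊎-dec d + e ≟ f) (0 ∷ 2 ∷ 4 ∷ 6 ∷ [])) offsets) offsets)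

      separating : ∀ u v → u ∉ C → v ∉ C → u ≢ v → I C u ≢ I C v
      separating u v u∉C v∉C u≢v I≡I with centred u | centred v
      ... | j , refl | i , refl with find (All.head (hitting j))
      ... | e , e∈ , ∈C with ∈I⁻ i (subst (⟨ j + e ⟩ ∈_) I≡I (∈I⁺ j e∈ refl ∈C))
      ... | f , f∈ , eq , _ with All.lookup (All.lookup differences e∈) f∈
      ... | inj₁ refl = u∉C ∈C
      ... | inj₂ (inj₁ refl) = v∉C (subst (_∈ C) eq ∈C)
      ... | inj₂ (inj₂ diff) with find diff
      ... | d , d∈ , inj₁ refl = conflict i j d d∈ eq u≢v I≡I
      ... | d , d∈ , inj₂ refl = conflict j i d d∈ (sym eq) (u≢v ∘ sym) (sym I≡I)

-- Periodic binary words and their windows.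

pattern ○ = false
pattern ● = true

nth : List Bool → ℕ → Bool
nth []      _       = false
nth (b ∷ w) zero    = b
nth (b ∷ w) (suc i) = nth w i

indicator : Bool → ℕ
indicator b = if b then 1 else 0

count : ℕ → (ℕ → Bool) → ℕ
count zero    c = 0
count (suc n) c = indicator (c 0) + count n (c ∘ suc)

count-snoc : ∀ n c → count (suc n) c ≡ count n c + indicator (c n)
count-snoc zero    c = +-identityʳ _
count-snoc (suc n) c = begin
  indicator (c 0) + count (suc n) (c ∘ suc)               ≡⟨ cong (indicator (c 0) +_) (count-snoc n (c ∘ suc)) ⟩
  indicator (c 0) + (count n (c ∘ suc) + indicator (c (suc n))) ≡⟨ +-assoc (indicator (c 0)) _ _ ⟨
  indicator (c 0) + count n (c ∘ suc) + indicator (c (suc n))   ∎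
  where open ≡-Reasoning

Periodic : ℕ → (ℕ → Bool) → Set
Periodic n c = ∀ i → c (n + i) ≡ c i

-- Sliding the range by one place loses `c 0` and gains `c n`, which periodicity makes equal.
count-shift : ∀ {n c} → Periodic n c → ∀ k → count n (c ∘ (k +_)) ≡ count n c
count-shift           per zero    = refl
count-shift {n} {c} per (suc k) = trans (count-shift {n} {c ∘ suc} per′ k)
  (+-cancelˡ-≡ (indicator (c 0)) _ _ (begin
    count (suc n) c                ≡⟨ count-snoc n c ⟩
    count n c + indicator (c n)    ≡⟨ cong (λ i → count n c + indicator (c i)) (+-identityʳ n) ⟨
    count n c + indicator (c (n + 0)) ≡⟨ cong (λ b → count n c + indicator b) (per 0) ⟩
    count n c + indicator (c 0)    ≡⟨ +-comm (count n c) _ ⟩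
    indicator (c 0) + count n c    ∎))
  where
  open ≡-Reasoning
  per′ : Periodic n (c ∘ suc)
  per′ i = trans (cong c (sym (+-suc n i))) (per (suc i))

-- A window lists its letters from the last to the first.
window : ℕ → (ℕ → Bool) → List Bool
window zero    c = []
window (suc k) c = c k ∷ window k c

window-cong : ∀ k {c c′} → (∀ {i} → i < k → c i ≡ c′ i) → window k c ≡ window k c′
window-cong zero    eq = refl
window-cong (suc k) eq = cong₂ _∷_ (eq ≤-refl) (window-cong k (eq ∘ m≤n⇒m≤1+n))

-- Boolean-valued, so that one evaluation can certify a property of every window.
allWords : ℕ → (List Bool → Bool) → Bool
allWords zero    P = P []
allWords (suc k) P = allWords k (P ∘ (○ ∷_)) ∧ allWords k (P ∘ (● ∷_))

allWords⇒window : ∀ k P → T (allWords k P) → ∀ c → T (P (window k c))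
allWords⇒window zero    P p c = p
allWords⇒window (suc k) P p c with Equivalence.to T-∧ p | c k
... | p₀ , p₁ | ○ = allWords⇒window k (P ∘ (○ ∷_)) p₀ c
... | p₀ , p₁ | ● = allWords⇒window k (P ∘ (● ∷_)) p₁ c

-- Local validity of factors of length 13.

locallyValid : (ℕ → Bool) → Bool
locallyValid c = all (any c) constraints

Valid : (ℕ → Bool) → Set
Valid c = ∀ j → T (locallyValid (λ e → c (j + e)))

-- The constraints reach up to offset 12, hence 13 letters; the backward listing puts position `e`
-- at index `12 ∸ e`.
validWord : List Bool → Bool
validWord w = locallyValid (λ e → nth w (12 ∸ e))

-- Dead ends of the window graph would require a much larger potential.
extendable : ℕ → List Bool → Bool
extendable zero    w = true
extendable (suc k) w = extends ○ ∨ extends ●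
  where
  extends : Bool → Bool
  extends b = validWord (b ∷ take 12 w) ∧ extendable k (b ∷ take 12 w)

-- The next letter of the word witnesses each extension; `take 12 (window 13 c)` computes to
-- `window 12 (c ∘ suc)`.
Valid⇒extendable : ∀ k c → Valid c → T (extendable k (window 13 c))
Valid⇒extendable zero    c valid = _
Valid⇒extendable (suc k) c valid
  with c 13 | valid 1 | Valid⇒extendable k (c ∘ suc) (valid ∘ suc)
... | ○ | v | e = Equivalence.from T-∨ (inj₁ (Equivalence.from T-∧ (v , e)))
... | ● | v | e = Equivalence.from (T-∨ {validWord (○ ∷ window 12 (c ∘ suc)) ∧ extendable k (○ ∷ window 12 (c ∘ suc))})
                    (inj₂ (Equivalence.from T-∧ (v , e)))

-- Costs and a potential on the window graph.

block : List Bool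
block = ● ∷ ● ∷ ○ ∷ ○ ∷ ○ ∷ ○ ∷ []

-- The six windows of (110000)^∞. Reversing this word only shifts it, so the backward listing yields
-- the same set.
rotations : List (List Bool)
rotations = map (λ k → take 12 (drop k (block ++ block ++ block))) (upTo 6)

Tight : List Bool → Set
Tight w = w ∈ᵥ rotations

-- The total is bounded by 17 (3 |C| - n), so 18 is the least total that forces 3 |C| - n to be at
-- least 2.
cost : List Bool → List Bool → ℕ
cost v w = if does (v ∈ᵥ? rotations) then (if does (w ∈ᵥ? rotations) then 0 else 18) else 1

stepCost : (ℕ → Bool) → ℕ
stepCost c = cost (window 12 c) (window 12 (c ∘ suc))

infix 5 _▵_

data Tree : Set where
  leaf : ℕ → Tree
  _▵_  : Tree → Tree → Tree

eval : Tree → List Bool → ℕ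
eval (leaf p) _       = p
eval (l ▵ r)  []      = 0
eval (l ▵ r)  (○ ∷ w) = eval l w
eval (l ▵ r)  (● ∷ w) = eval r w

-- A feasible (shortest-path) potential of the graph of windows with edge lengths
-- 17 (3 b − 1) − cost, found by computer and shifted to be non-negative; a node branches
-- on the next letter of the window, ○ to the left.
opaque
  potential : List Bool → ℕ
  potential = eval tree
    where
    tree : Tree
    tree =
      (((((leaf 0 ▵ leaf 18) ▵ (leaf 6 ▵ ((((leaf 32 ▵ leaf 39) ▵ leaf 36) ▵ leaf 45) ▵ leaf 48))) ▵
      (leaf 24 ▵ (((((leaf 30 ▵ (leaf 0 ▵ (leaf 49 ▵ leaf 60))) ▵ (leaf 36 ▵ leaf 57)) ▵ leaf 54) ▵
      leaf 63) ▵ (((((leaf 45 ▵ leaf 51) ▵ leaf 66) ▵ leaf 66) ▵ leaf 66) ▵ leaf 66)))) ▵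
      (((leaf 45 ▵ (leaf 42 ▵ leaf 45)) ▵ leaf 48) ▵ (((((leaf 48 ▵ (leaf 0 ▵ ((leaf 66 ▵ leaf 75) ▵
      leaf 78))) ▵ (leaf 54 ▵ leaf 75)) ▵ leaf 72) ▵ leaf 81) ▵ (((((leaf 63 ▵ leaf 69) ▵ leaf 84) ▵
      leaf 84) ▵ leaf 84) ▵ leaf 84)))) ▵ (((((leaf 0 ▵ (leaf 21 ▵ leaf 63)) ▵ (leaf 0 ▵ (leaf 51 ▵
      leaf 66))) ▵ (leaf 60 ▵ leaf 63)) ▵ ((((leaf 36 ▵ leaf 66) ▵ leaf 75) ▵ ((leaf 51 ▵ leaf 66) ▵
      leaf 96)) ▵ leaf 81)) ▵ (((((leaf 66 ▵ (leaf 0 ▵ (((leaf 83 ▵ leaf 84) ▵ leaf 93) ▵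
      leaf 96))) ▵ (leaf 72 ▵ leaf 93)) ▵ leaf 90) ▵ leaf 99) ▵ (((((leaf 81 ▵ leaf 87) ▵
      leaf 102) ▵ leaf 102) ▵ leaf 102) ▵ leaf 102)))) ▵ ((((((leaf 33 ▵ leaf 51) ▵ (leaf 39 ▵
      ((((leaf 66 ▵ leaf 72) ▵ leaf 69) ▵ leaf 78) ▵ leaf 81))) ▵ (leaf 57 ▵ ((((leaf 63 ▵
      leaf 69) ▵ leaf 87) ▵ leaf 96) ▵ (((((leaf 78 ▵ leaf 84) ▵ leaf 99) ▵ leaf 99) ▵ leaf 99) ▵
      leaf 99)))) ▵ (((leaf 78 ▵ (leaf 75 ▵ leaf 78)) ▵ leaf 81) ▵ leaf 81)) ▵ ((((leaf 54 ▵
      leaf 84) ▵ leaf 93) ▵ ((leaf 69 ▵ leaf 84) ▵ leaf 114)) ▵ leaf 99)) ▵ ((((((leaf 66 ▵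
      leaf 84) ▵ (leaf 72 ▵ ((((leaf 100 ▵ leaf 105) ▵ leaf 102) ▵ leaf 111) ▵ leaf 114))) ▵
      (leaf 90 ▵ (leaf 96 ▵ leaf 111))) ▵ leaf 108) ▵ ((((leaf 87 ▵ leaf 117) ▵ leaf 120) ▵
      ((leaf 102 ▵ leaf 117) ▵ leaf 120)) ▵ leaf 120)) ▵ (((((leaf 99 ▵ leaf 105) ▵ leaf 120) ▵
      leaf 120) ▵ leaf 120) ▵ leaf 120)))

-- In a word of 13 letters `drop 1` is the earlier window, `take 12` the later one and the head is
-- the appended letter. Adding 17 on the left avoids subtraction.
amortised realisable : List Bool → Bool
amortised w =
  cost (drop 1 w) (take 12 w) + 17 + potential (take 12 w) ≤ᵇ potential (drop 1 w) + 51 * indicator (nth w 0)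
realisable w = validWord w ∧ extendable 6 w

opaque
  unfolding potential
  -- Certified by evaluation over all 8192 words of length 13.
  amortised-or-unrealisable : allWords 13 (λ w → amortised w ∨ not (realisable w)) ≡ true
  amortised-or-unrealisable = refl

∨-not-elim : ∀ {a b} → T (a ∨ not b) → T b → T a
∨-not-elim {●}     _ _ = _
∨-not-elim {○} {●} () _

step : ∀ c → Valid c →
  stepCost c + 17 + potential (window 12 (c ∘ suc)) ≤
  potential (window 12 c) + 51 * indicator (c 12)
step c valid = ≤ᵇ⇒≤ (stepCost c + 17 + potential (window 12 (c ∘ suc))) _
  (∨-not-elim {amortised (window 13 c)} {realisable (window 13 c)}
    (allWords⇒window 13 (λ w → amortised w ∨ not (realisable w)) (Equivalence.from T-≡ amortised-or-unrealisable) c)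
    (Equivalence.from (T-∧ {validWord (window 13 c)}) (valid 0 , Valid⇒extendable 6 c valid)))

-- Summation over a period and the lower bound.

totalCost : ℕ → (ℕ → Bool) → ℕ
totalCost zero    c = 0
totalCost (suc n) c = stepCost c + totalCost n (c ∘ suc)

-- The intermediate potentials cancel. The appended letters begin at position 12, whence the shifted
-- count.
telescope : ∀ n c → Valid c →
  totalCost n c + 17 * n + potential (window 12 (c ∘ (n +_))) ≤ potential (window 12 c) + 51 * count n (c ∘ (12 +_))
telescope zero    c valid = ≤-reflexive (sym (+-identityʳ (potential (window 12 c))))
telescope (suc n) c valid =
  combine (stepCost c) (potential (window 12 (c ∘ suc))) (potential (window 12 c)) (indicator (c 12))
          (totalCost n (c ∘ suc)) (potential (window 12 (c ∘ suc ∘ (n +_)))) (count n (c ∘ suc ∘ (12 +_)))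
          (step c valid) (telescope n (c ∘ suc) (valid ∘ suc))
  where
  combine : ∀ k p₁ p₀ b t pₙ m → k + 17 + p₁ ≤ p₀ + 51 * b → t + 17 * n + pₙ ≤ p₁ + 51 * m →
    k + t + 17 * suc n + pₙ ≤ p₀ + 51 * (b + m)
  combine k p₁ p₀ b t pₙ m le₁ le₂ = +-cancelˡ-≤ p₁ _ _ (subst₂ _≤_ (lhs k p₁ t n pₙ) (rhs p₀ b p₁ m) (+-mono-≤ le₁ le₂))
    where
    lhs : ∀ k p₁ t n pₙ → k + 17 + p₁ + (t + 17 * n + pₙ) ≡ p₁ + (k + t + 17 * suc n + pₙ)
    lhs = solve-∀
    rhs : ∀ p₀ b p₁ m → p₀ + 51 * b + (p₁ + 51 * m) ≡ p₁ + (p₀ + 51 * (b + m))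
    rhs = solve-∀

-- Over a full period the first and last windows agree, so their potentials cancel too.
totalCost-bound : ∀ n c → Valid c → Periodic n c → totalCost n c + 17 * n ≤ 51 * count n c
totalCost-bound n c valid per = +-cancelʳ-≤ (potential (window 12 c)) _ _ (begin
  totalCost n c + 17 * n + potential (window 12 c)
    ≡⟨ cong (λ w → totalCost n c + 17 * n + potential w) (window-cong 12 (λ {i} _ → per i)) ⟨
  totalCost n c + 17 * n + potential (window 12 (c ∘ (n +_)))
    ≤⟨ telescope n c valid ⟩
  potential (window 12 c) + 51 * count n (c ∘ (12 +_))
    ≡⟨ cong (λ m → potential (window 12 c) + 51 * m) (count-shift {n} {c} per 12) ⟩
  potential (window 12 c) + 51 * count n c
    ≡⟨ +-comm (potential (window 12 c)) _ ⟩
  51 * count n c + potential (window 12 c) ∎)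
  where open ≤-Reasoning

cost-exit : ∀ v w → Tight v → ¬ Tight w → cost v w ≡ 18
cost-exit v w t ¬t =
  cong₂ (λ a b → if a then (if b then 0 else 18) else 1) (dec-true (v ∈ᵥ? rotations) t) (dec-false (w ∈ᵥ? rotations) ¬t)

cost-loose : ∀ v w → ¬ Tight v → cost v w ≡ 1
cost-loose v w ¬t =
  cong (λ a → if a then (if does (w ∈ᵥ? rotations) then 0 else 18) else 1) (dec-false (v ∈ᵥ? rotations) ¬t)

starts-tight : ∀ n c → Tight (window 12 c) →
  18 ≤ totalCost n c ⊎ (∀ j → j ≤ n → Tight (window 12 (c ∘ (j +_))))
starts-tight zero    c t = inj₂ λ { _ z≤n → t }
starts-tight (suc n) c t with window 12 (c ∘ suc) ∈ᵥ? rotations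
... | no ¬t = inj₁ (≤-trans (≤-reflexive (sym (cost-exit (window 12 c) (window 12 (c ∘ suc)) t ¬t))) (m≤m+n _ _))
... | yes t′ with starts-tight n (c ∘ suc) t′
...   | inj₁ le  = inj₁ (≤-trans le (m≤n+m _ (stepCost c)))
...   | inj₂ all = inj₂ λ { zero _ → t ; (suc j) (s≤s j≤n) → all j j≤n }

-- Either no window before the end is tight, so that every step costs 1, or some tight window is
-- followed by an exit, which costs 18.
ends-loose : ∀ n c → ¬ Tight (window 12 (c ∘ (n +_))) → 18 ≤ totalCost n c ⊎ n ≤ totalCost n c
ends-loose zero    c ¬t = inj₂ z≤n
ends-loose (suc n) c ¬t with ends-loose n (c ∘ suc) ¬t
... | inj₁ le = inj₁ (≤-trans le (m≤n+m _ (stepCost c)))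
... | inj₂ le with window 12 c ∈ᵥ? rotations
...   | no ¬t₀ = inj₂ (+-mono-≤ (≤-reflexive (sym (cost-loose (window 12 c) (window 12 (c ∘ suc)) ¬t₀))) le)
...   | yes t₀ with starts-tight (suc n) c t₀
...     | inj₁ le′ = inj₁ le′
...     | inj₂ all = contradiction (all (suc n) ≤-refl) ¬t

Tight-period : ∀ c → Tight (window 12 c) → c 0 ≡ c 6
-- The backward listing puts `c 0` at index 11 and `c 6` at index 5.
Tight-period c t = All.lookup (from-yes (all? (λ w → nth w 11 Bool.≟ nth w 5) rotations)) t

-- No rotation of 110000 by 1 to 5 places fixes it, as comparing six letters of each tight window
-- with their shift by `r` shows.
Tight-aperiodic : ∀ (r : Fin 6) c → Tight (window 12 c) → (∀ {i} → i < 6 → c i ≡ c (toℕ r + i)) → toℕ r ≡ 0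
Tight-aperiodic r c t eq with All.lookup (from-yes (all? (λ w → all? (λ r →
  ¬? (≡-dec Bool._≟_ (drop 6 w) (take 6 (drop (6 ∸ r) w)))) (1 ∷ 2 ∷ 3 ∷ 4 ∷ 5 ∷ [])) rotations)) t
... | ≢₁ ∷ ≢₂ ∷ ≢₃ ∷ ≢₄ ∷ ≢₅ ∷ [] = go r eq
  where
  go : ∀ r → (∀ {i} → i < 6 → c i ≡ c (toℕ r + i)) → toℕ r ≡ 0
  go 0F _  = refl
  go 1F eq = contradiction (window-cong 6 eq) ≢₁
  go 2F eq = contradiction (window-cong 6 eq) ≢₂
  go 3F eq = contradiction (window-cong 6 eq) ≢₃
  go 4F eq = contradiction (window-cong 6 eq) ≢₄
  go 5F eq = contradiction (window-cong 6 eq) ≢₅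

iterate-period : ∀ {N} {c : ℕ → Bool} → (∀ {j} → j ≤ N → c j ≡ c (6 + j)) →
  ∀ k x → k * 6 + x ≤ 6 + N → c x ≡ c (k * 6 + x)
iterate-period eq zero    x _  = refl
iterate-period eq (suc k) x le =
  trans (iterate-period eq k x (≤-trans (m≤n+m _ 6) le)) (eq (+-cancelˡ-≤ 6 _ _ le))

-- Periods 6 and `n` together give the shift `n % 6`, which must vanish by aperiodicity.
all-tight⇒6∣n : ∀ n c → Periodic n c → (∀ j → j ≤ n → Tight (window 12 (c ∘ (j +_)))) → n % 6 ≡ 0
all-tight⇒6∣n n c per all with n divMod 6
... | result q r n≡ = trans (cong (_% 6) n≡) (trans ([m+kn]%n≡m%n (toℕ r) q 6)
  (cong (_% 6) (Tight-aperiodic r c (all 0 z≤n) λ {i} i<6 → begin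
    c i                     ≡⟨ per i ⟨
    c (n + i)               ≡⟨ cong c (split i) ⟩
    c (q * 6 + (toℕ r + i)) ≡⟨ iterate-period period q (toℕ r + i) (bound i i<6) ⟨
    c (toℕ r + i)           ∎)))
  where
  open ≡-Reasoning
  period : ∀ {j} → j ≤ n → c j ≡ c (6 + j)
  period {j} j≤n = subst₂ (λ x y → c x ≡ c y) (+-identityʳ j) (+-comm j 6) (Tight-period (c ∘ (j +_)) (all j j≤n))
  split : ∀ i → n + i ≡ q * 6 + (toℕ r + i)
  split i = trans (cong (_+ i) (trans n≡ (+-comm (toℕ r) _))) (+-assoc (q * 6) (toℕ r) i)
  bound : ∀ i → i < 6 → q * 6 + (toℕ r + i) ≤ 6 + n
  bound i i<6 = subst (_≤ 6 + n) (split i) (subst (_≤ 6 + n) (+-comm i n) (+-monoˡ-≤ n (<⇒≤ i<6)))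

Valid⇒n≤3count : ∀ n c → Valid c → Periodic n c → n ≤ 3 * count n c
Valid⇒n≤3count n c valid per = *-cancelˡ-≤ 17 (begin
  17 * n                  ≤⟨ m≤n+m (17 * n) (totalCost n c) ⟩
  totalCost n c + 17 * n  ≤⟨ totalCost-bound n c valid per ⟩
  51 * count n c          ≡⟨ *-assoc 17 3 (count n c) ⟩
  17 * (3 * count n c)    ∎)
  where open ≤-Reasoning

Valid⇒2+n≤3count : ∀ n c → 17 < n → n % 6 ≢ 0 → Valid c → Periodic n c → 2 + n ≤ 3 * count n c
Valid⇒2+n≤3count n c 17<n 6∤n valid per = *-cancelˡ-< 17 _ _ (begin-strict
  17 * suc n              ≡⟨ *-suc 17 n ⟩
  -- The strict inequality comes from cost 18 against 17, and turns `1 + n` into `2 + n` after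
  -- cancelling 17.
  17 + 17 * n             <⟨ +-monoˡ-≤ (17 * n) expensive ⟩
  totalCost n c + 17 * n  ≤⟨ totalCost-bound n c valid per ⟩
  51 * count n c          ≡⟨ *-assoc 17 3 (count n c) ⟩
  17 * (3 * count n c)    ∎)
  where
  open ≤-Reasoning
  expensive : 18 ≤ totalCost n c
  expensive with window 12 c ∈ᵥ? rotations
  -- By periodicity the window at `n` is the one at 0, so it is not tight either.
  ... | no ¬t = [ (λ le → le) , ≤-trans 17<n ] (ends-loose n c (¬t ∘ subst Tight (window-cong 12 (λ {i} _ → per i))))
  ... | yes t = [ (λ le → le) , (λ all → contradiction (all-tight⇒6∣n n c per all) 6∤n) ] (starts-tight n c t)

-- Cardinalities, orders, and the periodic word of a code.

∣∣≡count : ∀ {n} (C : Subset n) c → (∀ i → lookup C i ≡ c (toℕ i)) → ∣ C ∣ ≡ count n c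
∣∣≡count []      c eq = refl
∣∣≡count (○ ∷ C) c eq rewrite sym (eq Fin.zero) = ∣∣≡count C (c ∘ suc) (eq ∘ Fin.suc)
∣∣≡count (● ∷ C) c eq rewrite sym (eq Fin.zero) = cong suc (∣∣≡count C (c ∘ suc) (eq ∘ Fin.suc))

-- Every n above 17 has the form `order k s` with `s` its residue modulo 6; `weight k s` is the
-- claimed minimum.
order weight : ℕ → Fin 6 → ℕ
order k s = 18 + (k * 6 + toℕ s)
weight k s = k * 2 + base s
  where
  base : Fin 6 → ℕ
  base 0F = 6
  base 1F = 7
  base 5F = 9
  base _  = 8

order%6 : ∀ k s → order k s % 6 ≡ toℕ s % 6
order%6 k s = trans
  (cong (_% 6) (trans (sym (+-assoc 18 (k * 6) (toℕ s))) (+-comm (18 + k * 6) (toℕ s))))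
  ([m+kn]%n≡m%n (toℕ s) (3 + k) 6)

module Word (m : ℕ) (12<n : 12 < suc m) (C : Subset (suc m)) where
  open Circulant m 12<n

  at : ℕ → Bool
  at i = lookup C ⟨ i ⟩

  at-periodic : Periodic n at
  at-periodic i = cong (lookup C) (⟨⟩-cong (trans (cong (_% n) (+-comm n i)) ([m+n]%n≡m%n i n)))

  ∣C∣≡count : ∣ C ∣ ≡ count n at
  ∣C∣≡count = ∣∣≡count C at λ i →
    cong (lookup C) (toℕ-injective (trans (sym (m<n⇒m%n≡m (toℕ<n i))) (sym (toℕ-⟨⟩ (toℕ i)))))

  Hitting⇒Valid : Hitting C → Valid at
  Hitting⇒Valid hitting j = all⁻ (any (λ e → at (j + e)))
    (All.map (any⁺ _ ∘ Any.map (λ ∈C → Equivalence.from T-≡ ([]=⇒lookup ∈C))) (hitting j))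

  Valid⇒Hitting : Valid at → Hitting C
  Valid⇒Hitting valid j =
    All.map (λ {S} p → Any.map (λ t → lookup⇒[]= _ C (Equivalence.to T-≡ t)) (any⁻ (λ e → at (j + e)) S p))
      (all⁺ (any (λ e → at (j + e))) constraints (valid j))

-- Codes attaining the bound.

codeTail : ℕ → Fin 6 → List Bool
codeTail (suc k) s = block ++ codeTail k s
codeTail zero 1F = ● ∷ ● ∷ ○ ∷ ○ ∷ ● ∷ ○ ∷ ○ ∷ []
codeTail zero 2F = block ++ ● ∷ ● ∷ []
codeTail zero 3F = block ++ ● ∷ ● ∷ ○ ∷ []
codeTail zero 4F = block ++ ● ∷ ● ∷ ○ ∷ ○ ∷ []
codeTail zero 5F = block ++ ● ∷ ● ∷ ○ ∷ ○ ∷ ● ∷ []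
codeTail zero 0F = block

-- Both leading blocks are fixed: they are the 12 letters that windows read after wrapping around,
-- so appending them linearises the cyclic word.
code : ℕ → Fin 6 → List Bool
code k s = block ++ block ++ codeTail k s

validFor : ℕ → (ℕ → Bool) → Bool
validFor zero    c = true
validFor (suc n) c = locallyValid c ∧ validFor n (c ∘ suc)

validFor⇒locallyValid : ∀ n c → T (validFor n c) → ∀ {j} → j < n → T (locallyValid (λ e → c (j + e)))
validFor⇒locallyValid (suc n) c p {zero}  _         = proj₁ (Equivalence.to T-∧ p)
validFor⇒locallyValid (suc n) c p {suc j} (s≤s j<n) =
  validFor⇒locallyValid n (c ∘ suc) (proj₂ (Equivalence.to (T-∧ {locallyValid c}) p)) j<n

code-validFor : ∀ k s → T (validFor (order k s) (nth (code k s ++ block ++ block)))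
-- The first six factors stay within the 18 letters of three blocks, so their checks evaluate to
-- true, and the claim for `k` remains.
code-validFor (suc k) s = code-validFor k s
code-validFor zero 0F = _
code-validFor zero 1F = _
code-validFor zero 2F = _
code-validFor zero 3F = _
code-validFor zero 4F = _
code-validFor zero 5F = _

code-count : ∀ k s → count (order k s) (nth (code k s)) ≡ weight k s
code-count (suc k) s = cong (2 +_) (code-count k s)
code-count zero 0F = refl
code-count zero 1F = refl
code-count zero 2F = refl
code-count zero 3F = refl
code-count zero 4F = refl
code-count zero 5F = refl

length-code : ∀ k s → length (code k s) ≡ order k s
length-code (suc k) s = cong (6 +_) (length-code k s)
length-code zero 0F = refl
length-code zero 1F = refl
length-code zero 2F = refl
length-code zero 3F = refl
length-code zero 4F = refl
length-code zero 5F = refl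

nth-++ˡ : ∀ v w {i} → i < length v → nth (v ++ w) i ≡ nth v i
nth-++ˡ (b ∷ v) w {zero}  _         = refl
nth-++ˡ (b ∷ v) w {suc i} (s≤s i<∣v∣) = nth-++ˡ v w i<∣v∣

nth-++ʳ : ∀ v w i → nth (v ++ w) (length v + i) ≡ nth w i
nth-++ʳ []      w i = refl
nth-++ʳ (b ∷ v) w i = nth-++ʳ v w i

nth-cyclic : ∀ {n} .{{_ : NonZero n}} u v {i} → length (u ++ v) ≡ n → i < n + length u →
  nth ((u ++ v) ++ u) i ≡ nth (u ++ v) (i % n)
nth-cyclic u v {i} refl i< with i <? length (u ++ v)
... | yes i<n = trans (nth-++ˡ (u ++ v) u i<n) (cong (nth (u ++ v)) (sym (m<n⇒m%n≡m i<n)))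
... | no i≮n with j , refl ← m≤n⇒∃[o]m+o≡n (≮⇒≥ i≮n) = begin
  nth ((u ++ v) ++ u) (n + j)  ≡⟨ nth-++ʳ (u ++ v) u j ⟩
  nth u j                      ≡⟨ nth-++ˡ u v j<∣u∣ ⟨
  nth (u ++ v) j               ≡⟨ cong (nth (u ++ v)) (m<n⇒m%n≡m (<-≤-trans j<∣u∣ ∣u∣≤n)) ⟨
  nth (u ++ v) (j % n)         ≡⟨ cong (nth (u ++ v)) ([m+n]%n≡m%n j n) ⟨
  nth (u ++ v) ((j + n) % n)   ≡⟨ cong (λ x → nth (u ++ v) (x % n)) (+-comm j n) ⟩
  nth (u ++ v) ((n + j) % n)   ∎
  where
  open ≡-Reasoning
  n : ℕ
  n = length (u ++ v)
  j<∣u∣ : j < length u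
  j<∣u∣ = +-cancelˡ-< n _ _ i<
  ∣u∣≤n : length u ≤ n
  ∣u∣≤n = subst (length u ≤_) (sym (length-++ u)) (m≤m+n _ _)

-- `locallyValid c` computes to `validWord (window 13 c)`.
locallyValid-cong : ∀ {c c′} → (∀ {i} → i < 13 → c i ≡ c′ i) → locallyValid c ≡ locallyValid c′
locallyValid-cong {c} {c′} eq = cong validWord (window-cong 13 {c} {c′} eq)

-- Rounding the lower bound, and minimality.

-- For residues 1 and 4, `n ≤ 3 * m` already forces `2 + n ≤ 3 * m` by divisibility; only residues
-- 2, 3 and 5 draw on the stronger bound, taken with `d = 2`.
weight-bound : ∀ k s m → order k s ≤ 3 * m → (toℕ s % 6 ≢ 0 → 2 + order k s ≤ 3 * m) → weight k s ≤ m
weight-bound k s m = go s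
  where
  fit : ∀ d w s → {True (w * 3 ≤? d + 20 + toℕ s)} → d + order k s ≤ 3 * m → k * 2 + w ≤ m
  -- An integer whose triple is at most `2 + 3 * m` is at most `m`.
  fit d w s {small} le = s≤s⁻¹ (*-cancelʳ-< 3 (k * 2 + w) (suc m) (s≤s (begin
    (k * 2 + w) * 3         ≡⟨ lhs k w ⟩
    k * 6 + w * 3           ≤⟨ +-monoʳ-≤ (k * 6) (toWitness small) ⟩
    k * 6 + (d + 20 + toℕ s) ≡⟨ rhs k d (toℕ s) ⟩
    2 + (d + order k s)     ≤⟨ +-monoʳ-≤ 2 le ⟩
    2 + 3 * m               ≡⟨ cong (2 +_) (*-comm 3 m) ⟩
    2 + m * 3               ∎)))
    where
    open ≤-Reasoning
    lhs : ∀ k w → (k * 2 + w) * 3 ≡ k * 6 + w * 3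
    lhs = solve-∀
    rhs : ∀ k d s → k * 6 + (d + 20 + s) ≡ 2 + (d + (18 + (k * 6 + s)))
    rhs = solve-∀
  go : ∀ s → order k s ≤ 3 * m → (toℕ s % 6 ≢ 0 → 2 + order k s ≤ 3 * m) → weight k s ≤ m
  go 0F le _ = fit 0 6 0F le
  go 1F le _ = fit 0 7 1F le
  go 2F _ le = fit 2 8 2F (le λ ())
  go 3F _ le = fit 2 8 3F (le λ ())
  go 4F le _ = fit 0 8 4F le
  go 5F _ le = fit 2 9 5F (le λ ())

module _ (k : ℕ) (s : Fin 6) where

  private
    12<order : 12 < order k s
    12<order = s≤s (≤-trans (toWitness {a? = 12 ≤? 17} _) (m≤m+n 17 _))

  codeSubset : Subset (order k s)
  codeSubset = tabulate (nth (code k s) ∘ toℕ)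

  ∣codeSubset∣ : ∣ codeSubset ∣ ≡ weight k s
  ∣codeSubset∣ = trans (∣∣≡count codeSubset (nth (code k s)) (lookup∘tabulate (nth (code k s) ∘ toℕ))) (code-count k s)

  codeSubset-isLD : IsLD (order k s) codeSubset
  codeSubset-isLD = Hitting⇒IsLD codeSubset (Valid⇒Hitting valid)
    where
    open Circulant (17 + (k * 6 + toℕ s)) 12<order
    open Word (17 + (k * 6 + toℕ s)) 12<order codeSubset
    extended : ℕ → Bool
    extended = nth (code k s ++ block ++ block)
    at≡extended : ∀ j {e} → e < 13 → at (j + e) ≡ extended (j % n + e)
    at≡extended j {e} e<13 = begin
      lookup codeSubset ⟨ j + e ⟩           ≡⟨ lookup∘tabulate (nth (code k s) ∘ toℕ) ⟨ j + e ⟩ ⟩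
      nth (code k s) (toℕ ⟨ j + e ⟩)        ≡⟨ cong (nth (code k s)) (toℕ-⟨⟩ (j + e)) ⟩
      nth (code k s) ((j + e) % n)          ≡⟨ cong (nth (code k s)) ([m%n+o]%n≡[m+o]%n j e n) ⟨
      -- Positions reach at most `n + 11`, within the twelve appended letters.
      nth (code k s) ((j % n + e) % n)      ≡⟨ nth-cyclic (block ++ block) (codeTail k s) (length-code k s)
                                                  (+-mono-<-≤ (m%n<n j n) (s≤s⁻¹ e<13)) ⟨
      extended (j % n + e)                  ∎
      where open ≡-Reasoning
    valid : Valid at
    valid j = subst T (sym (locallyValid-cong (at≡extended j)))
      (validFor⇒locallyValid n extended (code-validFor k s) (m%n<n j n))

  weight-minimal : ∀ C → IsLD (order k s) C → weight k s ≤ ∣ C ∣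
  weight-minimal C ld = subst (weight k s ≤_) (sym ∣C∣≡count) (weight-bound k s (count n at) lower lower⁺)
    where
    open Circulant (17 + (k * 6 + toℕ s)) 12<order
    open Word (17 + (k * 6 + toℕ s)) 12<order C
    valid : Valid at
    valid = Hitting⇒Valid (IsLD⇒Hitting C ld)
    lower : n ≤ 3 * count n at
    lower = Valid⇒n≤3count n at valid at-periodic
    lower⁺ : toℕ s % 6 ≢ 0 → 2 + n ≤ 3 * count n at
    lower⁺ s≢0 = Valid⇒2+n≤3count n at (m≤m+n 18 _) (s≢0 ∘ trans (sym (order%6 k s))) valid at-periodic

γLD-order : ∀ k s → γLD≡ (order k s) (weight k s)
γLD-order k s =
  (codeSubset k s , codeSubset-isLD k s , ∣codeSubset∣ k s) , weight-minimal k s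

-- Ceilings and the residue classes modulo 6.

⌈order/3⌉ : ∀ k s → ⌈ order k s /3⌉ ≡ k * 2 + (20 + toℕ s) / 3
⌈order/3⌉ k s = begin
  (order k s + 2) / 3                   ≡⟨ cong (_/ 3) (rearrange k (toℕ s)) ⟩
  (k * 2 * 3 + (20 + toℕ s)) / 3        ≡⟨ +-distrib-/-∣ˡ (20 + toℕ s) (divides (k * 2) refl) ⟩
  k * 2 * 3 / 3 + (20 + toℕ s) / 3      ≡⟨ cong (_+ (20 + toℕ s) / 3) (m*n/n≡m (k * 2) 3) ⟩
  k * 2 + (20 + toℕ s) / 3              ∎
  where
  open ≡-Reasoning
  rearrange : ∀ k s → 18 + (k * 6 + s) + 2 ≡ k * 2 * 3 + (20 + s)
  rearrange = solve-∀

order-surjective : ∀ n → 17 < n → ∃₂ λ k s → n ≡ order k s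
order-surjective n 17<n with (n ∸ 18) divMod 6
... | result k s n∸18≡ =
  k , s , trans (sym (m+[n∸m]≡n 17<n)) (cong (18 +_) (trans n∸18≡ (+-comm (toℕ s) (k * 6))))

Exact : ℕ → Set
Exact r = r ≡ 0 ⊎ r ≡ 1 ⊎ r ≡ 4

-- For `s` from 0 to 5 the quotients are 6, 7, 7, 7, 8, 8 and the base weights 6, 7, 8, 8, 8, 9.
weight-⌈/3⌉ : ∀ k s → (Exact (toℕ s % 6) × weight k s ≡ k * 2 + (20 + toℕ s) / 3)
                    ⊎ (¬ Exact (toℕ s % 6) × weight k s ≡ k * 2 + ((20 + toℕ s) / 3 + 1))
weight-⌈/3⌉ k 0F = inj₁ (inj₁ refl , refl)
weight-⌈/3⌉ k 1F = inj₁ (inj₂ (inj₁ refl) , refl)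
weight-⌈/3⌉ k 2F = inj₂ ((λ { (inj₁ ()) ; (inj₂ (inj₁ ())) ; (inj₂ (inj₂ ())) }) , refl)
weight-⌈/3⌉ k 3F = inj₂ ((λ { (inj₁ ()) ; (inj₂ (inj₁ ())) ; (inj₂ (inj₂ ())) }) , refl)
weight-⌈/3⌉ k 4F = inj₁ (inj₂ (inj₂ refl) , refl)
weight-⌈/3⌉ k 5F = inj₂ ((λ { (inj₁ ()) ; (inj₂ (inj₁ ())) ; (inj₂ (inj₂ ())) }) , refl)

Claim : ℕ → Set
Claim n = (Exact (n % 6) → γLD≡ n ⌈ n /3⌉) × (¬ Exact (n % 6) → γLD≡ n (⌈ n /3⌉ + 1))

claim : ∀ k s → Claim (order k s)
claim k s = [ exact , inexact ]′ (weight-⌈/3⌉ k s)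
  where
  exact : Exact (toℕ s % 6) × weight k s ≡ k * 2 + (20 + toℕ s) / 3 → Claim (order k s)
  exact (e , eq) =
    (λ _ → subst (γLD≡ (order k s)) (trans eq (sym (⌈order/3⌉ k s))) (γLD-order k s)) ,
    (λ ¬e → contradiction (subst Exact (sym (order%6 k s)) e) ¬e)
  inexact : ¬ Exact (toℕ s % 6) × weight k s ≡ k * 2 + ((20 + toℕ s) / 3 + 1) → Claim (order k s)
  inexact (¬e , eq) =
    (λ e → contradiction (subst Exact (order%6 k s) e) ¬e) ,
    (λ _ → subst (γLD≡ (order k s)) (begin
      weight k s                            ≡⟨ eq ⟩
      k * 2 + ((20 + toℕ s) / 3 + 1)        ≡⟨ +-assoc (k * 2) ((20 + toℕ s) / 3) 1 ⟨
      k * 2 + (20 + toℕ s) / 3 + 1          ≡⟨ cong (_+ 1) (⌈order/3⌉ k s) ⟨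
      ⌈ order k s /3⌉ + 1                   ∎) (γLD-order k s))
    where open ≡-Reasoning

theorem10 : (n : ℕ) → 17 < n →
    ((n % 6 ≡ 0 ⊎ n % 6 ≡ 1 ⊎ n % 6 ≡ 4) → γLD≡ n ⌈ n /3⌉)
    × (¬ (n % 6 ≡ 0 ⊎ n % 6 ≡ 1 ⊎ n % 6 ≡ 4) → γLD≡ n (⌈ n /3⌉ + 1))
theorem10 n 17<n = let k , s , n≡order = order-surjective n 17<n in
  subst Claim (sym n≡order) (claim k s)
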